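{- Let $\lambda/\mu$ be a skew partition and let $i\in\mathbb N_+$. Then there exists an involution $\mathbf B_i:\operatorname{RPP}(\lambda/\mu)\to\operatorname{RPP}(\lambda/\mu)$ which preserves the ceq statistic (i.e. $\operatorname{ceq}(\mathbf B_i(T))=\operatorname{ceq}(T)$ for all $T$) and acts on the ircont statistic by the transposition of its $i$-th and $(i+1)$-th entries (i.e. $\operatorname{ircont}(\mathbf B_i(T))$ is obtained from $\operatorname{ircont}(T)$ by switching its $i$-th and $(i+1)$-th entries, for all $T$).
   Context: $\mathbb N_+=\{1,2,3,\ldots\}$. A weak composition is a sequence $\alpha=(\alpha_1,\alpha_2,\ldots)$ of nonnegative integers with finite sum; a partition is a weakly decreasing weak composition, identified with its Young diagram $\{(i,j)\in\mathbb N_+^2\mid j\le\lambda_i\}$ (matrix/English notation: $i$ is the row, growing downwards; $j$ is the column). A skew partition $\lambda/\mu$ is a pair of partitions with $\mu\subseteq\lambda$; $\lambda/\mu$ also denotes the set difference of the diagrams. A filling of $\lambda/\mu$ is a map $T:\lambda/\mu\to\mathbb N_+$. A reverse plane partition (rpp) of shape $\lambda/\mu$ is a filling whose entries increase weakly from left to right along rows and weakly from top to bottom down columns. $\operatorname{RPP}(\lambda/\mu)$ is the set of all rpps of shape $\lambda/\mu$. For a filling $T$, $\operatorname{ircont}(T)$ is the weak composition $(r_1,r_2,\ldots)$ where $r_i$ is the number of columns of $T$ that contain an entry equal to $i$. $\operatorname{ceq}(T)$ is the weak composition $(c_1,c_2,\ldots)$ where $c_i$ is the number of $j\in\mathbb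 N_+$ such that $(i,j)$ and $(i+1,j)$ are both cells of $\lambda/\mu$ and $T(i,j)=T(i+1,j)$. -}

module Defs where

open import Data.Irrelevant using ([_])
open import Data.List.Base using (length; filter; map; upTo)
open import Data.List.Properties using (filter-none)
import Data.List.Relation.Unary.All as All
open import Data.Nat.Base using (ℕ; zero; suc; _≤_; _<_; _⊔_; z≤n; s≤s; s≤s⁻¹)
import Data.Nat.Properties as ℕ
open import Data.Product.Base using (_×_; _,_; proj₁; proj₂; ∃-syntax; Σ-syntax)
open import Data.Refinement using (Refinement-syntax; _,_)
open import Data.Sum.Base using (inj₁; inj₂)
open import Level using (0ℓ)
open import Relation.Binary.Bundles using (Setoid)
import Relation.Binary.Construct.On as On
open import Relation.Binary.Definitions using (DecidableEquality)
open import Relation.Binary.PropositionalEquality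
  using (_≡_; refl; cong; subst; _→-setoid_)
open import Relation.Nullary using (¬_; Dec; yes; no; contradiction; map′; ¬?; _×-dec_)
open import Relation.Unary using (Pred; Decidable; _∈_; _⊆_; _∖_)

-- Literally {1, 2, 3, …}: `1+ n` is the number n + 1.

record ℕ₊ : Set where
  constructor 1+_
  field
    pred : ℕ

  toℕ : ℕ
  toℕ = suc pred

open ℕ₊ public using (toℕ)

next : ℕ₊ → ℕ₊
next (1+ n) = 1+ suc n

infix 4 _≤₊_ _≟₊_

_≤₊_ : ℕ₊ → ℕ₊ → Set
i ≤₊ j = toℕ i ≤ toℕ j

_≟₊_ : DecidableEquality ℕ₊
(1+ m) ≟₊ (1+ n) = map′ (cong 1+_) (cong ℕ₊.pred) (m ℕ.≟ n)

transpose : ℕ₊ → ℕ₊ → ℕ₊ → ℕ₊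
transpose i j k with k ≟₊ i
... | yes _ = j
... | no  _ with k ≟₊ j
...   | yes _ = i
...   | no  _ = k

-- A sequence of natural numbers has a finite sum exactly when it vanishes
-- from some point on.

record WeakComposition : Set where
  field
    part   : ℕ₊ → ℕ
    finite : ∃[ n ] (∀ {i} → n < toℕ i → part i ≡ 0)

open WeakComposition public

record Partition : Set where
  field
    composition : WeakComposition
    decreasing  : ∀ {i j} → i ≤₊ j → part composition j ≤ part composition i

  open WeakComposition composition public

-- Matrix notation: (i , j) is the cell in row i and column j.

Diagram : Partition → Pred (ℕ₊ × ℕ₊) 0ℓ
Diagram α (i , j) = toℕ j ≤ Partition.part α i

record SkewPartition : Set where
  field
    outer inner : Partition
    inner⊆outer : Diagram inner ⊆ Diagram outer

open SkewPartition public

SkewDiagram : SkewPartition → Pred (ℕ₊ × ℕ₊) 0ℓ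
SkewDiagram s = Diagram (outer s) ∖ Diagram (inner s)

-- Membership in the diagram is proof-irrelevant here, so that a filling
-- depends on positions only.

Cell : SkewPartition → Set
Cell s = [ p ∈ ℕ₊ × ℕ₊ ∣ p ∈ SkewDiagram s ]

Filling : SkewPartition → Set
Filling s = Cell s → ℕ₊

record RPP (s : SkewPartition) : Set where
  field
    filling     : Filling s
    row-weak    : ∀ {i j j′} (c : (i , j) ∈ SkewDiagram s) (c′ : (i , j′) ∈ SkewDiagram s) →
                  j ≤₊ j′ → filling ((i , j) , [ c ]) ≤₊ filling ((i , j′) , [ c′ ])
    column-weak : ∀ {i i′ j} (c : (i , j) ∈ SkewDiagram s) (c′ : (i′ , j) ∈ SkewDiagram s) →
                  i ≤₊ i′ → filling ((i , j) , [ c ]) ≤₊ filling ((i′ , j) , [ c′ ])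

open RPP public

-- Two rpps are equal when they have the same entry in every cell.

RPPₛ : SkewPartition → Setoid 0ℓ 0ℓ
RPPₛ s = On.setoid (Cell s →-setoid ℕ₊) (filling {s})

-- The cardinality of a decidable set of positive integers bounded by n; the
-- bound does not influence the result, it only makes the count finite.

card : {P : Pred ℕ₊ 0ℓ} → Decidable P → (n : ℕ) → .(∀ {j} → P j → toℕ j ≤ n) → ℕ
card P? n _ = length (filter P? (map 1+_ (upTo n)))

private
  card-none : {P : Pred ℕ₊ 0ℓ} (P? : Decidable P) (n : ℕ) .(b : ∀ {j} → P j → toℕ j ≤ n) →
              (∀ j → ¬ P j) → card P? n b ≡ 0
  card-none P? n _ none =
    cong length (filter-none P? {xs = map 1+_ (upTo n)} (All.universal none _))

  maxBelow : (ℕ → ℕ) → ℕ → ℕ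
  maxBelow f zero    = 0
  maxBelow f (suc n) = f n ⊔ maxBelow f n

  ≤maxBelow : ∀ (f : ℕ → ℕ) {m} n → m < n → f m ≤ maxBelow f n
  ≤maxBelow f (suc n) m<1+n with ℕ.m≤n⇒m<n∨m≡n (s≤s⁻¹ m<1+n)
  ... | inj₁ m<n  = ℕ.≤-trans (≤maxBelow f n m<n) (ℕ.m≤n⊔m (f n) _)
  ... | inj₂ refl = ℕ.m≤m⊔n (f n) _

module _ (s : SkewPartition) where

  inDiagram? : Decidable (SkewDiagram s)
  inDiagram? (i , j) =
    (toℕ j ℕ.≤? Partition.part (outer s) i) ×-dec ¬? (toℕ j ℕ.≤? Partition.part (inner s) i)

  rowBound columnBound : ℕ
  rowBound    = proj₁ (Partition.finite (outer s))
  columnBound = Partition.part (outer s) (1+ 0)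

  row≤ : ∀ {i j} → (i , j) ∈ SkewDiagram s → toℕ i ≤ rowBound
  row≤ {i} {j} (j≤λᵢ , _) with toℕ i ℕ.≤? rowBound
  ... | yes i≤ = i≤
  ... | no  i≰ = contradiction
    (subst (toℕ j ≤_) (proj₂ (Partition.finite (outer s)) (ℕ.≰⇒> i≰)) j≤λᵢ) λ ()

  column≤ : ∀ {i j} → (i , j) ∈ SkewDiagram s → toℕ j ≤ columnBound
  column≤ (j≤λᵢ , _) =
    ℕ.≤-trans j≤λᵢ (Partition.decreasing (outer s) (s≤s z≤n))

module _ (s : SkewPartition) (T : Filling s) where

  ColumnContains : ℕ₊ → Pred ℕ₊ 0ℓ
  ColumnContains k j = ∃[ i ] Σ[ c ∈ (i , j) ∈ SkewDiagram s ] T ((i , j) , [ c ]) ≡ k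

  EqualBelow : ℕ₊ → Pred ℕ₊ 0ℓ
  EqualBelow i j = Σ[ c ∈ (i , j) ∈ SkewDiagram s ] Σ[ c′ ∈ (next i , j) ∈ SkewDiagram s ]
                   T ((i , j) , [ c ]) ≡ T ((next i , j) , [ c′ ])

  private
    entryIs? : ∀ k p → Dec (Σ[ c ∈ p ∈ SkewDiagram s ] T (p , [ c ]) ≡ k)
    entryIs? k p with inDiagram? s p
    ... | no  p∉ = no λ (c , _) → p∉ c
    ... | yes c  = map′ (c ,_) proj₂ (T (p , [ c ]) ≟₊ k)

    entry : ℕ₊ × ℕ₊ → ℕ
    entry p with inDiagram? s p
    ... | no  _ = 0
    ... | yes c = toℕ (T (p , [ c ]))

    entry≡ : ∀ p (c : p ∈ SkewDiagram s) → entry p ≡ toℕ (T (p , [ c ]))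
    entry≡ p c with inDiagram? s p
    ... | no  p∉ = contradiction c p∉
    ... | yes _  = refl

    maxInRow : ℕ → ℕ
    maxInRow i = maxBelow (λ j → entry (1+ i , 1+ j)) (columnBound s)

    maxEntry : ℕ
    maxEntry = maxBelow maxInRow (rowBound s)

    entry≤ : ∀ p (c : p ∈ SkewDiagram s) → toℕ (T (p , [ c ])) ≤ maxEntry
    entry≤ p@(1+ i , 1+ j) c = subst (_≤ maxEntry) (entry≡ p c)
      (ℕ.≤-trans (≤maxBelow (λ j → entry (1+ i , 1+ j)) (columnBound s) (column≤ s c))
                 (≤maxBelow maxInRow (rowBound s) (row≤ s c)))

  columnContains? : ∀ k → Decidable (ColumnContains k)
  columnContains? k j = map′ (λ (i , _ , e) → 1+ i , e)
                             (λ (i , c , e) → ℕ₊.pred i , row≤ s c , c , e)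
                             (ℕ.anyUpTo? (λ i → entryIs? k (1+ i , j)) (rowBound s))

  equalBelow? : ∀ i → Decidable (EqualBelow i)
  equalBelow? i j with inDiagram? s (next i , j)
  ... | no  p∉ = no λ (_ , c′ , _) → p∉ c′
  ... | yes c′ = map′ (λ (c , e) → c , c′ , e) (λ (c , _ , e) → c , e)
                      (entryIs? (T ((next i , j) , [ c′ ])) (i , j))

  ircont : WeakComposition
  ircont .part k = card (columnContains? k) (columnBound s) λ (_ , c , _) → column≤ s c
  ircont .finite = maxEntry , λ {k} max<k →
    card-none (columnContains? k) (columnBound s) (λ (_ , c , _) → column≤ s c)
      λ { j (i , c , refl) → ℕ.<⇒≱ max<k (entry≤ (i , j) c) }

  ceq : WeakComposition
  ceq .part i = card (equalBelow? i) (columnBound s) λ (c , _) → column≤ s c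
  ceq .finite = rowBound s , λ {i} bound<i →
    card-none (equalBelow? i) (columnBound s) (λ (c , _) → column≤ s c)
      λ { j (c , _) → ℕ.<⇒≱ bound<i (row≤ s c) }

-- Fix i and T. In column j let a ≤ b ≤ c be the numbers of cells of the outer
-- shape that lie in the inner shape or have an entry < i, ≤ i and ≤ i + 1
-- respectively. Given the entries outside {i, i + 1}, which determine a and c,
-- the rpp amounts to a weakly decreasing sequence b with a ≤ b ≤ c. Encode b
-- as a word: 0 where b = a, a large number N where a < b = c, and b elsewhere,
-- that is, where both i and i + 1 occur. Exchange 0 and N in the columns with
-- a < c; this may make b increase somewhere, which is repaired by swapping the
-- letters of two adjacent columns where b increases. The repair terminates and
-- is locally confluent, so by Newman's lemma its result is unique. Exchanging
-- 0 and N reverses each repair step, hence the whole map is an involution.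
-- Repairing permutes the letters; the letters ≠ 0 count the columns containing
-- i, and the letters other than 0 and N determine the contribution to ceq.

module Submission where

open import Defs
open import Algebra.Definitions using (Involutive)
open import Data.Irrelevant using ([_])
open import Data.List.Base using (List; []; _∷_; length; filter; map; applyUpTo; upTo)
open import Data.List.Properties using (∷-injective; length-applyUpTo; map-upTo; filter-≐)
open import Data.List.Relation.Binary.Permutation.Propositional
  using (_↭_; ↭-refl; ↭-sym; ↭-trans; prep; swap)
open import Data.List.Relation.Binary.Permutation.Propositional.Properties
  using (↭-length; filter-↭; All-resp-↭)
open import Data.List.Relation.Unary.All using ([]; _∷_)
open import Data.List.Relation.Unary.AllPairs using (AllPairs; []; _∷_)
import Data.List.Relation.Unary.AllPairs.Properties as AllPairs
open import Data.Nat.Base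
  using (ℕ; zero; suc; _+_; _⊔_; _⊓_; _≤_; _<_; _≤′_; ≤′-refl; ≤′-step; z≤n; s≤s; s≤s⁻¹)
open import Data.Nat.Induction using (<-wellFounded)
open import Data.Nat.Properties
open import Data.Product.Base using (∃-syntax; Σ-syntax; _×_; _,_; proj₁; proj₂; map₂)
open import Data.Refinement using (_,_)
open import Data.Sum.Base using (_⊎_; inj₁; inj₂)
open import Function.Base using (_∘_; _on_; id)
open import Function.Bundles using (_⇔_; mk⇔; Equivalence; _⟶ₛ_; _⟨$⟩_)
open import Function.Construct.Composition using (_⇔-∘_)
open import Function.Construct.Symmetry using (⇔-sym)
open import Induction.WellFounded using (Acc; acc; module Subrelation)
open import Level using (0ℓ)
open import Relation.Binary.Bundles using (Setoid)
open import Relation.Binary.Construct.Closure.ReflexiveTransitive using (Star; ε; _◅_; _◅◅_; gmap)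
open import Relation.Binary.Construct.Closure.Transitive using (Plus; [_]; _∼⁺⟨_⟩_)
import Relation.Binary.Construct.On as On
open import Relation.Binary.PropositionalEquality
  using (_≡_; _≢_; _≗_; refl; sym; trans; cong; cong₂; subst; subst₂; ≢-sym; module ≡-Reasoning)
open import Relation.Binary.Rewriting
  using (IsNormalForm; StronglyNormalizing; WeaklyConfluent; Confluent; sn&wcr⇒cr)
open import Relation.Nullary using (¬_; Dec; yes; no; contradiction; ¬?; _×-dec_; recompute)
open import Relation.Unary using (Pred; Decidable; _∈_)
open Equivalence using (to; from)

-- Counting the elements of tabulated lists.

module _ {A B : Set} where

  length-filter-applyUpTo :
    {P : Pred A 0ℓ} {Q : Pred B 0ℓ} (P? : Decidable P) (Q? : Decidable Q)
    {f : ℕ → A} {g : ℕ → B} → (∀ j → P (f j) ⇔ Q (g j)) →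
    ∀ n → length (filter P? (applyUpTo f n)) ≡ length (filter Q? (applyUpTo g n))
  length-filter-applyUpTo P? Q? P⇔Q zero = refl
  length-filter-applyUpTo P? Q? {f} {g} P⇔Q (suc n)
    with P? (f 0) | Q? (g 0) | length-filter-applyUpTo P? Q? (P⇔Q ∘ suc) n
  ... | yes _ | yes _ | eq = cong suc eq
  ... | no _  | no _  | eq = eq
  ... | yes p | no ¬q | _  = contradiction (P⇔Q 0 .to p) ¬q
  ... | no ¬p | yes q | _  = contradiction (P⇔Q 0 .from q) ¬p

  -- A disjoint union counted index by index, where the second summand is observed on another list.
  -- It serves to separate the old equalities of a collapsed filling from the new ones.
  length-filter-split :
    {P Q : Pred A 0ℓ} {R : Pred B 0ℓ} (P? : Decidable P) (Q? : Decidable Q) (R? : Decidable R)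
    {f : ℕ → A} {g : ℕ → B} →
    (∀ j → P (f j) ⇔ (Q (f j) ⊎ R (g j))) → (∀ j → Q (f j) → ¬ R (g j)) →
    ∀ n → length (filter P? (applyUpTo f n)) ≡
          length (filter Q? (applyUpTo f n)) + length (filter R? (applyUpTo g n))
  length-filter-split P? Q? R? P⇔ Q¬R zero = refl
  length-filter-split P? Q? R? {f} {g} P⇔ Q¬R (suc n)
    with P? (f 0) | Q? (f 0) | R? (g 0) | length-filter-split P? Q? R? (P⇔ ∘ suc) (Q¬R ∘ suc) n
  ... | _     | yes q | yes r | _  = contradiction r (Q¬R 0 q)
  ... | no ¬p | yes q | _     | _  = contradiction (P⇔ 0 .from (inj₁ q)) ¬p
  ... | no ¬p | _     | yes r | _  = contradiction (P⇔ 0 .from (inj₂ r)) ¬p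
  ... | no _  | no _  | no _  | eq = eq
  ... | yes _ | yes _ | no _  | eq = cong suc eq
  ... | yes _ | no _  | yes _ | eq = trans (cong suc eq) (sym (+-suc _ _))
  ... | yes p | no ¬q | no ¬r | _  with P⇔ 0 .to p
  ...   | inj₁ q = contradiction q ¬q
  ...   | inj₂ r = contradiction r ¬r

-- Heights of downward closed sets of numbers.

module _ {P : Pred ℕ 0ℓ} (P? : Decidable P) where

  -- One more than the largest element of `P` below the bound, which for downward closed `P` is the
  -- number of elements below the bound.
  height : ℕ → ℕ
  height zero    = 0
  height (suc n) with P? n
  ... | yes _ = suc n
  ... | no  _ = height n

  height-≤ : ∀ n → height n ≤ n
  height-≤ zero    = z≤n
  height-≤ (suc n) with P? n
  ... | yes _ = ≤-refl
  ... | no  _ = m≤n⇒m≤1+n (height-≤ n)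

  <height⁺ : ∀ {r} n → r < n → P r → r < height n
  <height⁺ (suc n) r<1+n Pr with P? n
  ... | yes _  = r<1+n
  ... | no ¬Pn with m≤n⇒m<n∨m≡n (s≤s⁻¹ r<1+n)
  ...   | inj₁ r<n  = <height⁺ n r<n Pr
  ...   | inj₂ refl = contradiction Pr ¬Pn

  <height⁻ : (∀ {r r′} → r ≤ r′ → P r′ → P r) → ∀ {r} n → r < height n → P r
  <height⁻ closed (suc n) r<h with P? n
  ... | yes Pn = closed (s≤s⁻¹ r<h) Pn
  ... | no  _  = <height⁻ closed n r<h

-- Repairing words by adjacent swaps, and decoding them.

Antitone : (ℕ → ℕ) → Set
Antitone f = ∀ j → f (suc j) ≤ f j

antitone-≤ : ∀ {f} → Antitone f → ∀ {i j} → i ≤ j → f j ≤ f i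
antitone-≤ {f} anti i≤j = go (≤⇒≤′ i≤j)
  where
  go : ∀ {i j} → i ≤′ j → f j ≤ f i
  go ≤′-refl       = ≤-refl
  go (≤′-step i≤j) = ≤-trans (anti _) (go i≤j)

-- Equivalently a ⊔ t < c′ ⊓ t′; see clamp below.
Conflict : (a c′ t t′ : ℕ) → Set
Conflict a c′ t t′ = (a < c′) × (a < t′) × (t < c′) × (t < t′)

conflict? : ∀ a c′ t t′ → Dec (Conflict a c′ t t′)
conflict? a c′ t t′ = a <? c′ ×-dec a <? t′ ×-dec t <? c′ ×-dec t <? t′

-- Letters move while the bounds stay with their columns. For antitone bounds, `a 0` and `c 1` are
-- the tighter ones of the two columns involved.
data Step (a c : ℕ → ℕ) : List ℕ → List ℕ → Set where
  here  : ∀ {t t′ ts} → Conflict (a 0) (c 1) t t′ → Step a c (t ∷ t′ ∷ ts) (t′ ∷ t ∷ ts)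
  there : ∀ {t ts us} → Step (a ∘ suc) (c ∘ suc) ts us → Step a c (t ∷ ts) (t ∷ us)

Steps : (a c : ℕ → ℕ) → List ℕ → List ℕ → Set
Steps a c = Star (Step a c)

theres : ∀ {a c t ts us} → Steps (a ∘ suc) (c ∘ suc) ts us → Steps a c (t ∷ ts) (t ∷ us)
theres = gmap (_ ∷_) there

step-resp-≗ : ∀ {a a′ c c′} → a ≗ a′ → c ≗ c′ → ∀ {ts us} → Step a c ts us → Step a′ c′ ts us
step-resp-≗ a≗ c≗ (here x) rewrite a≗ 0 | c≗ 1 = here x
step-resp-≗ a≗ c≗ (there s) = there (step-resp-≗ (a≗ ∘ suc) (c≗ ∘ suc) s)

step⇒↭ : ∀ {a c ts us} → Step a c ts us → ts ↭ us
step⇒↭ (here _)  = swap _ _ ↭-refl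
step⇒↭ (there s) = prep _ (step⇒↭ s)

steps⇒↭ : ∀ {a c ts us} → Steps a c ts us → ts ↭ us
steps⇒↭ ε        = ↭-refl
steps⇒↭ (s ◅ ss) = ↭-trans (step⇒↭ s) (steps⇒↭ ss)

step? : ∀ a c ts → Dec (∃[ us ] Step a c ts us)
step? a c []       = no λ ()
step? a c (t ∷ []) = no λ { (_ , there ()) }
step? a c (t ∷ t′ ∷ ts) with conflict? (a 0) (c 1) t t′ | step? (a ∘ suc) (c ∘ suc) (t′ ∷ ts)
... | yes x | _            = yes (_ , here x)
... | no _  | yes (_ , s)  = yes (_ , there s)
... | no ¬x | no ¬s        = no λ { (_ , here x) → ¬x x ; (_ , there s) → ¬s (_ , s) }

-- weight [t₀, t₁, …] = Σₖ k tₖ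
total weight : List ℕ → ℕ
total []        = 0
total (t ∷ ts)  = t + total ts
weight []       = 0
weight (t ∷ ts) = total ts + weight ts

step-total : ∀ {a c ts us} → Step a c ts us → total us ≡ total ts
step-total {ts = t ∷ t′ ∷ ts} (here _) = begin
  t′ + (t + total ts)  ≡⟨ +-assoc t′ t _ ⟨
  t′ + t + total ts    ≡⟨ cong (_+ total ts) (+-comm t′ t) ⟩
  t + t′ + total ts    ≡⟨ +-assoc t t′ _ ⟩
  t + (t′ + total ts)  ∎
  where open ≡-Reasoning
step-total (there s) = cong (_ +_) (step-total s)

-- A swap moves the larger letter one place to the left, to a position of smaller coefficient, so
-- the weight drops by `t′ - t`.
step-weight : ∀ {a c ts us} → Step a c ts us → weight us < weight ts
step-weight {ts = _ ∷ _ ∷ ts} (here (_ , _ , _ , t<t′)) =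
  +-monoˡ-< (total ts + weight ts) (+-monoˡ-< (total ts) t<t′)
step-weight {ts = _ ∷ ts} {us = _ ∷ us} (there s) rewrite step-total s =
  +-monoʳ-< (total ts) (step-weight s)

stronglyNormalizing : ∀ {a c} → StronglyNormalizing (Plus (Step a c))
stronglyNormalizing = Subrelation.wellFounded decreases (On.wellFounded weight <-wellFounded)
  where
  decreases : ∀ {a c us ts} → Plus (Step a c) ts us → weight us < weight ts
  decreases [ s ]           = step-weight s
  decreases (_ ∼⁺⟨ p ⟩ q) = <-trans (decreases q) (decreases p)

normalise : ∀ a c ts → ∃[ us ] IsNormalForm (Step a c) us × Steps a c ts us
normalise a c ts = go ts (On.wellFounded weight <-wellFounded ts)
  where
  go : ∀ ts → Acc (_<_ on weight) ts → ∃[ us ] IsNormalForm (Step a c) us × Steps a c ts us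
  go ts (acc rs) with step? a c ts
  ... | no  nf      = ts , nf , ε
  ... | yes (us , s) with go us (rs (step-weight s))
  ...   | vs , nf , ss = vs , nf , s ◅ ss

weaklyConfluent : ∀ {a c} → Antitone a → Antitone c → WeaklyConfluent (Step a c)
weaklyConfluent a↘ c↘ (here _) (here _) = _ , ε , ε
weaklyConfluent a↘ c↘ (here x) (there (there s)) = _ , theres (theres (s ◅ ε)) , here x ◅ ε
weaklyConfluent a↘ c↘ (there (there s)) (here x) = _ , here x ◅ ε , theres (theres (s ◅ ε))
weaklyConfluent a↘ c↘ (there r) (there s) with weaklyConfluent (a↘ ∘ suc) (c↘ ∘ suc) r s
... | _ , rs , ss = _ , theres rs , theres ss
-- The critical pair: on `t₀ < t₁ < t₂` both orders of swapping end in `t₂ t₁ t₀`. The missing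
-- inequalities `t₁ < c 1` and `a 1 < t₁` come from `c 2 ≤ c 1` and `a 1 ≤ a 0`.
weaklyConfluent {a} {c} a↘ c↘
  (here x@(a₀<c₁ , a₀<t₁ , t₀<c₁ , t₀<t₁)) (there (here y@(a₁<c₂ , a₁<t₂ , t₁<c₂ , t₁<t₂))) = _ ,
    there (here (a₁<c₂ , a₁<t₂ , <-trans t₀<t₁ t₁<c₂ , t₀<t₂)) ◅
    here (a₀<c₁ , <-trans a₀<t₁ t₁<t₂ , <-≤-trans t₁<c₂ (c↘ 1) , t₁<t₂) ◅ ε ,
    here (a₀<c₁ , <-trans a₀<t₁ t₁<t₂ , t₀<c₁ , t₀<t₂) ◅
    there (here (a₁<c₂ , ≤-<-trans (a↘ 0) a₀<t₁ , <-trans t₀<t₁ t₁<c₂ , t₀<t₁)) ◅ ε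
  where t₀<t₂ = <-trans t₀<t₁ t₁<t₂
weaklyConfluent {a} {c} a↘ c↘ r@(there (here _)) s@(here _) with weaklyConfluent a↘ c↘ s r
... | _ , ss , rs = _ , rs , ss

confluent : ∀ {a c} → Antitone a → Antitone c → Confluent (Step a c)
confluent a↘ c↘ = sn&wcr⇒cr stronglyNormalizing (weaklyConfluent a↘ c↘)

normal-unique : ∀ {a c ts us vs} → Antitone a → Antitone c →
                Steps a c ts us → IsNormalForm (Step a c) us →
                Steps a c ts vs → IsNormalForm (Step a c) vs → us ≡ vs
normal-unique a↘ c↘ ss us-nf rs vs-nf with confluent a↘ c↘ ss rs
... | _ , ε     , ε     = refl
... | _ , s ◅ _ , _     = contradiction (_ , s) us-nf
... | _ , ε     , r ◅ _ = contradiction (_ , r) vs-nf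

-- Decodes a letter: for `a ≤ c`, the letter 0 gives `a`, any letter at least `c` gives `c`, and a
-- letter between them gives itself.
clamp : (a c t : ℕ) → ℕ
clamp a c t = a ⊔ (c ⊓ t)

-- As `a′ ≤ a`, a rise can only come from `c′ ⊓ t′` exceeding `a ⊔ (c ⊓ t)`. As `c′ ≤ c`, the
-- minimum `c ⊓ t` must then be `t`, and all four inequalities of a conflict hold.
clamp-mono : ∀ {a a′ c c′ t t′} → a′ ≤ a → c′ ≤ c → ¬ Conflict a c′ t t′ →
             clamp a′ c′ t′ ≤ clamp a c t
clamp-mono {a} {a′} {c} {c′} {t} {t′} a′≤a c′≤c ¬x = ⊔-lub (≤-trans a′≤a (m≤m⊔n a _)) (≮⇒≥ absurd)
  where
  absurd : ¬ (a ⊔ (c ⊓ t) < c′ ⊓ t′)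
  absurd lt = ¬x (<-≤-trans a< (m⊓n≤m c′ t′) , <-≤-trans a< (m⊓n≤n c′ t′) ,
                  <-≤-trans t< (m⊓n≤m c′ t′) , <-≤-trans t< (m⊓n≤n c′ t′))
    where
    a< : a < c′ ⊓ t′
    a< = m⊔n<o⇒m<o a _ lt
    c⊓t< : c ⊓ t < c′ ⊓ t′
    c⊓t< = m⊔n<o⇒n<o a _ lt
    t< : t < c′ ⊓ t′
    t< with ≤-total t c
    ... | inj₁ t≤c = subst (_< c′ ⊓ t′) (m≥n⇒m⊓n≡n t≤c) c⊓t<
    ... | inj₂ c≤t = contradiction (≤-trans (m⊓n≤m c′ t′) c′≤c)
                       (<⇒≱ (subst (_< c′ ⊓ t′) (m≤n⇒m⊓n≡m c≤t) c⊓t<))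

-- 0 past the end of the list.
at : List ℕ → ℕ → ℕ
at []       _       = 0
at (t ∷ _)  zero    = t
at (_ ∷ ts) (suc j) = at ts j

normal⇒antitone : ∀ {a c} → Antitone a → Antitone c → ∀ {ts} → IsNormalForm (Step a c) ts →
                  Antitone (λ j → clamp (a j) (c j) (at ts j))
-- The default letter 0 past the end causes no conflict, because nothing is smaller than 0.
normal⇒antitone a↘ c↘ {[]}          nf j       = clamp-mono (a↘ j) (c↘ j) λ ()
normal⇒antitone a↘ c↘ {t ∷ []}      nf zero    = clamp-mono (a↘ 0) (c↘ 0) λ ()
normal⇒antitone a↘ c↘ {t ∷ t′ ∷ ts} nf zero    = clamp-mono (a↘ 0) (c↘ 0) λ x → nf (_ , here x)
normal⇒antitone a↘ c↘ {t ∷ ts}      nf (suc j) =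
  normal⇒antitone (a↘ ∘ suc) (c↘ ∘ suc) (λ (_ , s) → nf (_ , there s)) j

-- Letters, and the exchange of 0 and `N`.

module Codes (N : ℕ) where

  -- The letter of b is code a c b; exchanging 0 and N turns it into code c a b.
  code : (x y b : ℕ) → ℕ
  code x y b with b ≟ x
  ... | yes _ = 0
  ... | no  _ with b ≟ y
  ...   | yes _ = N
  ...   | no  _ = b

  code-first : ∀ x y → code x y x ≡ 0
  code-first x y with x ≟ x
  ... | yes _   = refl
  ... | no  x≢x = contradiction refl x≢x

  code-second : ∀ {x y} → y ≢ x → code x y y ≡ N
  code-second {x} {y} y≢x with y ≟ x
  ... | yes y≡x = contradiction y≡x y≢x
  ... | no  _ with y ≟ y
  ...   | yes _   = refl
  ...   | no  y≢y = contradiction refl y≢y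

  code-other : ∀ {x y b} → b ≢ x → b ≢ y → code x y b ≡ b
  code-other {x} {y} {b} b≢x b≢y with b ≟ x
  ... | yes b≡x = contradiction b≡x b≢x
  ... | no  _ with b ≟ y
  ...   | yes b≡y = contradiction b≡y b≢y
  ...   | no  _   = refl

  -- Nonzero letters will mark the columns containing `i` (for `x = a`) or `i + 1` (for `x = c`).
  -- The second hypothesis prevents a letter copied from `b` from being 0 by accident.
  code-≢0 : ∀ {x y b} → N ≢ 0 → (b ≢ x → b ≢ y → b ≢ 0) → code x y b ≢ 0 ⇔ b ≢ x
  code-≢0 {x} {y} {b} N≢0 b≢0 with b ≟ x
  ... | yes b≡x = mk⇔ (λ 0≢0 → contradiction refl 0≢0) (λ b≢x → contradiction b≡x b≢x)
  ... | no  b≢x with b ≟ y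
  ...   | yes _   = mk⇔ (λ _ → b≢x) (λ _ → N≢0)
  ...   | no  b≢y = mk⇔ (λ _ → b≢x) (λ _ → b≢0 b≢x b≢y)

  code-≡ : ∀ {x y b v} → v ≢ 0 → v ≢ N → code x y b ≡ v → b ≡ v × b ≢ x × b ≢ y
  code-≡ {x} {y} {b} v≢0 v≢N eq with b ≟ x
  ... | yes _   = contradiction (sym eq) v≢0
  ... | no  b≢x with b ≟ y
  ...   | yes _   = contradiction (sym eq) v≢N
  ...   | no  b≢y = eq , b≢x , b≢y

  -- Besides exchanging 0 and `N`, the relation certifies that both letters are legal for a column
  -- with bounds `a` and `c`. In a column with `a ≡ c` the only legal letter is 0.
  data Flip (a c : ℕ) : ℕ → ℕ → Set where
    empty   : a ≡ c → Flip a c 0 0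
    raise   : a < c → Flip a c 0 N
    lower   : a < c → Flip a c N 0
    keep    : ∀ {t} → a < t → t < c → Flip a c t t

  flip-sym : ∀ {a c t u} → Flip a c t u → Flip a c u t
  flip-sym (empty p)  = empty p
  flip-sym (raise p)  = lower p
  flip-sym (lower p)  = raise p
  flip-sym (keep p q) = keep p q

  flip-≤ : ∀ {a c t u} → c ≤ N → Flip a c t u → t ≤ N
  flip-≤ c≤N (empty _)  = z≤n
  flip-≤ c≤N (raise _)  = z≤n
  flip-≤ c≤N (lower _)  = ≤-refl
  flip-≤ c≤N (keep _ q) = <⇒≤ (<-≤-trans q c≤N)

  flip-code : ∀ {a b c} → a ≤ b → b ≤ c → Flip a c (code a c b) (code c a b)
  flip-code {a} {b} {c} a≤b b≤c = go (b ≟ a) (b ≟ c)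
    where
    go : Dec (b ≡ a) → Dec (b ≡ c) → Flip a c (code a c b) (code c a b)
    go (yes refl) (yes refl) rewrite code-first a a = empty refl
    go (yes refl) (no  a≢c)  rewrite code-first a c | code-second a≢c = raise (≤∧≢⇒< b≤c a≢c)
    go (no  b≢a)  (yes refl) rewrite code-first c a | code-second b≢a = lower (≤∧≢⇒< a≤b (b≢a ∘ sym))
    go (no  b≢a)  (no  b≢c)  rewrite code-other b≢a b≢c | code-other b≢c b≢a =
      keep (≤∧≢⇒< a≤b (b≢a ∘ sym)) (≤∧≢⇒< b≤c b≢c)

  -- A legal letter is recovered from the value it decodes to; in particular `t` determines `u`.
  flip-clamp : ∀ {a c t u} → c ≤ N → Flip a c t u →
               code a c (clamp a c t) ≡ t × code c a (clamp a c t) ≡ u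
  flip-clamp {a} c≤N (empty refl) rewrite ⊓-zeroʳ a | ⊔-identityʳ a = code-first a a , code-first a a
  flip-clamp {a} {c} c≤N (raise a<c) rewrite ⊓-zeroʳ c | ⊔-identityʳ a =
    code-first a c , code-second (<⇒≢ a<c)
  flip-clamp {a} {c} c≤N (lower a<c) rewrite m≤n⇒m⊓n≡m c≤N | m≤n⇒m⊔n≡n (<⇒≤ a<c) =
    code-second (>⇒≢ a<c) , code-first c a
  flip-clamp c≤N (keep a<t t<c) rewrite m≥n⇒m⊓n≡n (<⇒≤ t<c) | m≤n⇒m⊔n≡n (<⇒≤ a<t) =
    code-other (>⇒≢ a<t) (<⇒≢ t<c) , code-other (<⇒≢ t<c) (>⇒≢ a<t)

  clamp-code : ∀ {a b c} → a ≤ b → b ≤ c → c ≤ N → clamp a c (code a c b) ≡ b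
  clamp-code {a} {b} {c} a≤b b≤c c≤N with b ≟ a
  ... | yes refl rewrite ⊓-zeroʳ c = ⊔-identityʳ a
  ... | no  _ with b ≟ c
  ...   | yes refl rewrite m≤n⇒m⊓n≡m c≤N = m≤n⇒m⊔n≡n a≤b
  ...   | no  _    rewrite m≥n⇒m⊓n≡n b≤c = m≤n⇒m⊔n≡n a≤b

  data Flips (a c : ℕ → ℕ) : List ℕ → List ℕ → Set where
    []  : Flips a c [] []
    _∷_ : ∀ {t u ts us} → Flip (a 0) (c 0) t u → Flips (a ∘ suc) (c ∘ suc) ts us →
          Flips a c (t ∷ ts) (u ∷ us)

  flips-sym : ∀ {a c ts us} → Flips a c ts us → Flips a c us ts
  flips-sym []       = []
  flips-sym (f ∷ fs) = flip-sym f ∷ flips-sym fs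

  flips-clamp : ∀ {a c ts us} → (∀ j → c j ≤ N) → Flips a c ts us →
                let b j = clamp (a j) (c j) (at ts j) ; n = length ts in
                applyUpTo (λ j → code (a j) (c j) (b j)) n ≡ ts ×
                applyUpTo (λ j → code (c j) (a j) (b j)) n ≡ us
  flips-clamp c≤N []       = refl , refl
  flips-clamp c≤N (f ∷ fs) with flip-clamp (c≤N 0) f | flips-clamp (c≤N ∘ suc) fs
  ... | p , q | ps , qs = cong₂ _∷_ p ps , cong₂ _∷_ q qs

  -- Swapping t < t′ with t ≠ 0 and t′ ≠ N would not be reversed by exchanging
  -- 0 and N; AllPairs NoRise excludes such swaps.
  NoRise : ℕ → ℕ → Set
  NoRise t t′ = t < t′ → t ≡ 0 ⊎ t′ ≡ N

  -- Only the swapped pair changes its relative order, and afterwards it falls, so the condition on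
  -- it is vacuous.
  step-noRise : ∀ {a c ts us} → Step a c ts us → AllPairs NoRise ts → AllPairs NoRise us
  step-noRise (here (_ , _ , _ , t<t′)) ((_ ∷ r) ∷ (r′ ∷ rs)) =
    ((λ t′<t → contradiction t<t′ (<-asym t′<t)) ∷ r′) ∷ (r ∷ rs)
  step-noRise (there s) (r ∷ rs) = All-resp-↭ (step⇒↭ s) r ∷ step-noRise s rs

  -- The exchange reverses a step: the admissible rises are `0 N`, `0 t′` and `t N`; swapped and
  -- then exchanged they read `0 N`, `t′ N` and `0 t`, which rise again, and swapping these gives
  -- the exchange of the original pair. Antitone bounds keep the letters legal in their new columns.
  flip-step : ∀ {a c ts us ts′} → Antitone a → Antitone c → (∀ j → c j ≤ N) →
              AllPairs NoRise ts → Flips a c ts ts′ → Step a c ts us →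
              ∃[ us′ ] Flips a c us us′ × Step a c us′ ts′
  flip-step a↘ c↘ c≤N (_ ∷ rs) (f ∷ fs) (there s)
    with flip-step (a↘ ∘ suc) (c↘ ∘ suc) (c≤N ∘ suc) rs fs s
  ... | _ , gs , s′ = _ , f ∷ gs , there s′
  flip-step {a} {c} a↘ c↘ c≤N ((r ∷ _) ∷ _) (f ∷ f′ ∷ fs) (here (a₀<c₁ , a₀<t′ , t<c₁ , t<t′)) =
    go f f′
    where
    a₀<c₀ : a 0 < c 0
    a₀<c₀ = <-≤-trans a₀<c₁ (c↘ 0)
    a₁<c₁ : a 1 < c 1
    a₁<c₁ = ≤-<-trans (a↘ 0) a₀<c₁
    go : ∀ {u u′} → Flip (a 0) (c 0) _ u → Flip (a 1) (c 1) _ u′ →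
         ∃[ us′ ] Flips a c _ us′ × Step a c us′ (u ∷ u′ ∷ _)
    go (empty a₀≡c₀) _          = contradiction a₀≡c₀ (<⇒≢ a₀<c₀)
    go f             (empty _)  = contradiction t<t′ n≮0
    go f             (raise _)  = contradiction t<t′ n≮0
    go (lower _)     f′         = contradiction (flip-≤ (c≤N 1) f′) (<⇒≱ t<t′)
    go (raise _)     (lower _)  = _ , lower a₀<c₀ ∷ raise a₁<c₁ ∷ fs , here (a₀<c₁ , a₀<t′ , t<c₁ , t<t′)
    go (raise _)     (keep _ t′<c₁) = _ , keep a₀<t′ (<-≤-trans t′<c₁ (c↘ 0)) ∷ raise a₁<c₁ ∷ fs ,
      here (a₀<c₁ , <-≤-trans a₀<c₁ (c≤N 1) , t′<c₁ , <-≤-trans t′<c₁ (c≤N 1))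
    go (keep a₀<t _) (lower _) = _ , lower a₀<c₀ ∷ keep (≤-<-trans (a↘ 0) a₀<t) t<c₁ ∷ fs ,
      here (a₀<c₁ , a₀<t , ≤-<-trans z≤n t<c₁ , ≤-<-trans z≤n a₀<t)
    go (keep a₀<t _) (keep _ t′<c₁) with r t<t′
    ... | inj₁ refl = contradiction a₀<t n≮0
    ... | inj₂ refl = contradiction (c≤N 1) (<⇒≱ t′<c₁)

  flip-steps : ∀ {a c ts us ts′} → Antitone a → Antitone c → (∀ j → c j ≤ N) →
               AllPairs NoRise ts → Flips a c ts ts′ → Steps a c ts us →
               ∃[ us′ ] Flips a c us us′ × Steps a c us′ ts′
  flip-steps a↘ c↘ c≤N rs fs ε = _ , fs , ε
  flip-steps a↘ c↘ c≤N rs fs (s ◅ ss) with flip-step a↘ c↘ c≤N rs fs s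
  ... | _ , gs , s′ with flip-steps a↘ c↘ c≤N (step-noRise s rs) gs ss
  ...   | _ , hs , ss′ = _ , hs , ss′ ◅◅ (s′ ◅ ε)

  code-view : ∀ x y b → code x y b ≡ 0 ⊎ code x y b ≡ N ⊎ code x y b ≡ b
  code-view x y b with b ≟ x
  ... | yes _ = inj₁ refl
  ... | no  _ with b ≟ y
  ...   | yes _ = inj₂ (inj₁ refl)
  ...   | no  _ = inj₂ (inj₂ refl)

  -- Letters copied from `b` and `b′` do not rise because `b′ ≤ b`, and `N` does not rise to a
  -- letter copied from `b′ ≤ N`.
  code-noRise : ∀ {x y b x′ y′ b′} → b′ ≤ N → b′ ≤ b → NoRise (code x y b) (code x′ y′ b′)
  code-noRise {x} {y} {b} {x′} {y′} {b′} b′≤N b′≤b lt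
    with code x y b | code-view x y b | code x′ y′ b′ | code-view x′ y′ b′
  ... | _ | inj₁ t≡0         | _ | _                 = inj₁ t≡0
  ... | _ | _                | _ | inj₁ refl         = contradiction lt n≮0
  ... | _ | _                | _ | inj₂ (inj₁ t′≡N)  = inj₂ t′≡N
  ... | _ | inj₂ (inj₁ refl) | _ | inj₂ (inj₂ refl)  = contradiction b′≤N (<⇒≱ lt)
  ... | _ | inj₂ (inj₂ refl) | _ | inj₂ (inj₂ refl)  = contradiction b′≤b (<⇒≱ lt)

  codes : (x y b : ℕ → ℕ) → ℕ → List ℕ
  codes x y b = applyUpTo (λ j → code (x j) (y j) (b j))

  -- The exchange affects only the letters 0 and `N`; the others are what `ceq` depends on.
  codes-swap-count : ∀ x y b {v} → v ≢ 0 → v ≢ N → ∀ n →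
    length (filter (_≟ v) (codes x y b n)) ≡ length (filter (_≟ v) (codes y x b n))
  codes-swap-count x y b {v} v≢0 v≢N = length-filter-applyUpTo (_≟ v) (_≟ v) λ j →
    mk⇔ (code-swap (x j) (y j) (b j)) (code-swap (y j) (x j) (b j))
    where
    code-swap : ∀ x y b → code x y b ≡ v → code y x b ≡ v
    code-swap x y b eq with code-≡ {x} {y} {b} v≢0 v≢N eq
    ... | b≡v , b≢x , b≢y = trans (code-other {y} {x} {b} b≢y b≢x) b≡v

  -- Profiles and the map that the exchange and the repair induce on them.

  record Profile (a c b : ℕ → ℕ) : Set where
    field
      a≤b : ∀ j → a j ≤ b j
      b≤c : ∀ j → b j ≤ c j
      b↘  : Antitone b

  open Profile

  tail : ∀ {a c b} → Profile a c b → Profile (a ∘ suc) (c ∘ suc) (b ∘ suc)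
  tail p = record { a≤b = a≤b p ∘ suc ; b≤c = b≤c p ∘ suc ; b↘ = b↘ p ∘ suc }

  codes-flips : ∀ {a c b} → Profile a c b → ∀ n → Flips a c (codes a c b n) (codes c a b n)
  codes-flips p zero    = []
  codes-flips p (suc n) = flip-code (a≤b p 0) (b≤c p 0) ∷ codes-flips (tail p) n

  codes-noRise : ∀ {a c b} → Profile a c b → (∀ j → c j ≤ N) → ∀ n → AllPairs NoRise (codes c a b n)
  codes-noRise p c≤N n = AllPairs.applyUpTo⁺₁ _ n λ {i} {j} i<j _ →
    code-noRise (≤-trans (b≤c p j) (c≤N j)) (antitone-≤ (b↘ p) (<⇒≤ i<j))

  -- A conflict would make the decoded value of the left column smaller than that of the right one,
  -- but these values are consecutive terms of the antitone `b`.
  codes-normal : ∀ {a c b} → Profile a c b → (∀ j → c j ≤ N) → ∀ n →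
                 IsNormalForm (Step a c) (codes a c b n)
  codes-normal p c≤N (suc zero)    (_ , there ())
  codes-normal p c≤N (suc (suc n)) (_ , there s) = codes-normal (tail p) (c≤N ∘ suc) (suc n) (_ , s)
  codes-normal {a} {c} {b} p c≤N (suc (suc n)) (_ , here (a₀<c₁ , a₀<t₁ , t₀<c₁ , t₀<t₁)) =
    contradiction (b↘ p 0) (<⇒≱ (begin-strict
      b 0                       ≡⟨ clamp-code (a≤b p 0) (b≤c p 0) (c≤N 0) ⟨
      clamp (a 0) (c 0) t₀      ≤⟨ ⊔-monoʳ-≤ (a 0) (m⊓n≤n (c 0) t₀) ⟩
      a 0 ⊔ t₀                  <⟨ ⊔-pres-<m (⊓-pres-m< a₀<c₁ a₀<t₁) (⊓-pres-m< t₀<c₁ t₀<t₁) ⟩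
      c 1 ⊓ t₁                  ≤⟨ m≤n⊔m (a 1) _ ⟩
      clamp (a 1) (c 1) t₁      ≡⟨ clamp-code (a≤b p 1) (b≤c p 1) (c≤N 1) ⟩
      b 1                       ∎))
    where
    open ≤-Reasoning
    t₀ = code (a 0) (c 0) (b 0)
    t₁ = code (a 1) (c 1) (b 1)

  code-resp : ∀ {x x′ y y′ b b′} → x ≡ x′ → y ≡ y′ → b ≡ b′ → code x y b ≡ code x′ y′ b′
  code-resp refl refl refl = refl

  codes-resp-≗ : ∀ {x x′ y y′ b b′} → x ≗ x′ → y ≗ y′ → b ≗ b′ → ∀ n → codes x y b n ≡ codes x′ y′ b′ n
  codes-resp-≗ x≗ y≗ b≗ zero    = refl
  codes-resp-≗ x≗ y≗ b≗ (suc n) = cong₂ _∷_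
    (code-resp (x≗ 0) (y≗ 0) (b≗ 0))
    (codes-resp-≗ (x≗ ∘ suc) (y≗ ∘ suc) (b≗ ∘ suc) n)

  -- The exchanged word of `b` is repaired to the word of `b′`; the latter is a normal form by
  -- `codes-normal` whenever `b′` is a profile.
  record Transfer (a c : ℕ → ℕ) (n : ℕ) (b b′ : ℕ → ℕ) : Set where
    constructor mkTransfer
    field steps : Steps a c (codes c a b n) (codes a c b′ n)

  transfer-resp-≗ : ∀ {a a₁ c c₁ b b₁ b′ b₁′ n} → a ≗ a₁ → c ≗ c₁ → b ≗ b₁ → b′ ≗ b₁′ →
                    Transfer a c n b b′ → Transfer a₁ c₁ n b₁ b₁′
  transfer-resp-≗ {n = n} a≗ c≗ b≗ b′≗ (mkTransfer ss) = mkTransfer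
    (subst₂ (Steps _ _) (codes-resp-≗ c≗ a≗ b≗ n) (codes-resp-≗ a≗ c≗ b′≗ n)
      (gmap id (step-resp-≗ a≗ c≗) ss))

  transfer-↭ : ∀ {a c n b b′} → Transfer a c n b b′ → codes c a b n ↭ codes a c b′ n
  transfer-↭ (mkTransfer ss) = steps⇒↭ ss

  module _ {a c : ℕ → ℕ} (a↘ : Antitone a) (c↘ : Antitone c) (c≤N : ∀ j → c j ≤ N) (n : ℕ) where

    transfer-exists : ∀ {b} → Profile a c b → ∃[ b′ ] Profile a c b′ × Transfer a c n b b′
    transfer-exists {b} p with normalise a c (codes c a b n)
    -- From `flip-steps` comes the legality of all letters of `us`, which makes `us` the word of its
    -- own decoding `b′`.
    ... | us , nf , ss with flip-steps a↘ c↘ c≤N (codes-noRise p c≤N n) (flips-sym (codes-flips p n)) ss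
    ...   | _ , fs , _ = b′ , p′ , mkTransfer (subst (Steps a c _) us≡ ss)
      where
      b′ : ℕ → ℕ
      b′ j = clamp (a j) (c j) (at us j)
      p′ : Profile a c b′
      p′ .a≤b j = m≤m⊔n (a j) _
      p′ .b≤c j = ⊔-lub (≤-trans (a≤b p j) (b≤c p j)) (m⊓n≤m (c j) _)
      p′ .b↘    = normal⇒antitone a↘ c↘ nf
      us≡ : us ≡ codes a c b′ n
      us≡ = trans (sym (proj₁ (flips-clamp c≤N fs)))
                  (cong (codes a c b′) (trans (sym (↭-length (steps⇒↭ ss))) (length-applyUpTo _ n)))

    -- The exchange reverses the whole repair path, which then leads from the exchanged word of `b′`
    -- to the word of `b`. This is the source of involutivity.
    transfer-sym : ∀ {b b′} → Profile a c b → Profile a c b′ → Transfer a c n b b′ → Transfer a c n b′ b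
    transfer-sym p p′ (mkTransfer ss)
      with flip-steps a↘ c↘ c≤N (codes-noRise p c≤N n) (flips-sym (codes-flips p n)) ss
    ... | _ , fs , ss′ = mkTransfer
      (subst (λ us → Steps a c us _) (flips-functional fs (codes-flips p′ n)) ss′)
      where
      flips-functional : ∀ {ts us us′} → Flips a c ts us → Flips a c ts us′ → us ≡ us′
      flips-functional fs fs′ = trans (sym (proj₂ (flips-clamp c≤N fs))) (proj₂ (flips-clamp c≤N fs′))

    -- The two words are normal forms of one word, hence equal, and `clamp` reads the profiles back
    -- from them in the first `n` columns.
    transfer-functional : ∀ {b b′ b″} → Profile a c b′ → Profile a c b″ →
                          Transfer a c n b b′ → Transfer a c n b b″ → ∀ {j} → j < n → b′ j ≡ b″ j
    transfer-functional {b} {b′} {b″} p′ p″ (mkTransfer ss) (mkTransfer rs) {j} j<n = begin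
      b′ j ≡⟨ clamp-code (a≤b p′ j) (b≤c p′ j) (c≤N j) ⟨
      clamp (a j) (c j) (code (a j) (c j) (b′ j)) ≡⟨ cong (clamp (a j) (c j)) (applyUpTo-injective n same j<n) ⟩
      clamp (a j) (c j) (code (a j) (c j) (b″ j)) ≡⟨ clamp-code (a≤b p″ j) (b≤c p″ j) (c≤N j) ⟩
      b″ j ∎
      where
      open ≡-Reasoning
      same : codes a c b′ n ≡ codes a c b″ n
      same = normal-unique a↘ c↘ ss (codes-normal p′ c≤N n) rs (codes-normal p″ c≤N n)
      applyUpTo-injective : ∀ {f g : ℕ → ℕ} n → applyUpTo f n ≡ applyUpTo g n →
                            ∀ {j} → j < n → f j ≡ g j
      applyUpTo-injective (suc n) eq {zero}  _   = proj₁ (∷-injective eq)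
      applyUpTo-injective (suc n) eq {suc j} (s≤s j<n) = applyUpTo-injective n (proj₂ (∷-injective eq)) j<n

-- Column heights of a filling.

<-extensional : ∀ {x y} → (∀ {r} → r < x → r < y) → x ≤ y
<-extensional x⊆y = ≮⇒≥ λ y<x → <-irrefl refl (x⊆y y<x)

toℕ-injective : ∀ {v w} → toℕ v ≡ toℕ w → v ≡ w
toℕ-injective eq = cong 1+_ (suc-injective eq)

module _ (s : SkewPartition) where

  diagram-closed : ∀ (α : Partition) {r r′ j j′} → r ≤ r′ → j ≤ j′ →
                   Diagram α (1+ r′ , 1+ j′) → Diagram α (1+ r , 1+ j)
  diagram-closed α r≤r′ j≤j′ x = ≤-trans (s≤s j≤j′) (≤-trans x (Partition.decreasing α (s≤s r≤r′)))

  -- The second component is vacuous on the inner shape, whose cells therefore lie below every `p`.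
  -- Here `r` and `j` count rows and columns from 0.
  Below : Filling s → ℕ → ℕ → ℕ → Set
  Below T p r j = Diagram (outer s) (1+ r , 1+ j) ×
                  (∀ (x : (1+ r , 1+ j) ∈ SkewDiagram s) → toℕ (T ((1+ r , 1+ j) , [ x ])) ≤ p)

  below? : ∀ T p r j → Dec (Below T p r j)
  below? T p r j with suc j ≤? Partition.part (outer s) (1+ r) | inDiagram? s (1+ r , 1+ j)
  ... | no ¬o | _     = no (¬o ∘ proj₁)
  ... | yes o | no ¬x = yes (o , λ x → contradiction x ¬x)
  ... | yes o | yes x with toℕ (T ((1+ r , 1+ j) , [ x ])) ≤? p
  ...   | yes ≤p = yes (o , λ _ → ≤p)
  ...   | no  ≰p = no λ (_ , f) → ≰p (f x)

  colHeight : Filling s → ℕ → ℕ → ℕ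
  colHeight T p j = height (λ r → below? T p r j) (rowBound s)

  ¬below⇒cell : ∀ (T : Filling s) {p r j} → Diagram (outer s) (1+ r , 1+ j) → ¬ Below T p r j →
                Σ[ x ∈ (1+ r , 1+ j) ∈ SkewDiagram s ] p < toℕ (T ((1+ r , 1+ j) , [ x ]))
  ¬below⇒cell T {p} {r} {j} o ¬b with inDiagram? s (1+ r , 1+ j)
  ... | no ¬x = contradiction (o , λ x → contradiction x ¬x) ¬b
  ... | yes x = x , ≰⇒> λ ≤p → ¬b (o , λ _ → ≤p)

  outer-row< : ∀ {r j} → Diagram (outer s) (1+ r , 1+ j) → r < rowBound s
  outer-row< {r} {j} o with suc r ≤? rowBound s
  ... | yes r< = r<
  ... | no  r≮ = contradiction (subst (suc j ≤_) (proj₂ (Partition.finite (outer s)) (≰⇒> r≮)) o) n≮0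

  module _ (T : RPP s) where

    private F = filling T

    below-closed : ∀ {p r r′ j j′} → r ≤ r′ → j ≤ j′ → Below F p r′ j′ → Below F p r j
    below-closed r≤r′ j≤j′ (o′ , f) = diagram-closed (outer s) r≤r′ j≤j′ o′ , λ (o , ¬i) →
      -- The comparison runs along row `r` to the corner `y` in column `j′`, then down to `x′`. Both
      -- are skew cells: moving right or down does not enter the inner shape, and `o′` keeps them in
      -- the outer one.
      let y  = diagram-closed (outer s) r≤r′ ≤-refl o′ , ¬i ∘ diagram-closed (inner s) ≤-refl j≤j′
          x′ = o′ , ¬i ∘ diagram-closed (inner s) r≤r′ j≤j′
      in ≤-trans (row-weak T (o , ¬i) y (s≤s j≤j′)) (≤-trans (column-weak T y x′ (s≤s r≤r′)) (f x′))

    <colHeight⁻ : ∀ {p r j} → r < colHeight F p j → Below F p r j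
    <colHeight⁻ {p} {j = j} = <height⁻ (λ r → below? F p r j) (λ r≤r′ → below-closed r≤r′ ≤-refl) (rowBound s)

  <colHeight⁺ : ∀ (T : Filling s) {p r j} → Below T p r j → r < colHeight T p j
  <colHeight⁺ T {p} {j = j} b = <height⁺ (λ r → below? T p r j) (rowBound s) (outer-row< (proj₁ b)) b

  colHeight-≤ : ∀ (T : RPP s) (U : Filling s) {p p′} →
                (∀ q → toℕ (filling T q) ≤ p → toℕ (U q) ≤ p′) →
                ∀ j → colHeight (filling T) p j ≤ colHeight U p′ j
  colHeight-≤ T U imp j = <-extensional λ r<h →
    let o , f = <colHeight⁻ T r<h in <colHeight⁺ U (o , λ x → imp _ (f x))

  colHeight-antitone : ∀ (T : RPP s) p → Antitone (colHeight (filling T) p)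
  colHeight-antitone T p j = <-extensional λ r<h →
    <colHeight⁺ (filling T) (below-closed T ≤-refl (n≤1+n j) (<colHeight⁻ T r<h))

  columnContains⇔ : ∀ (T : RPP s) p j →
    ColumnContains s (filling T) (1+ p) (1+ j) ⇔
    (colHeight (filling T) p j ≢ colHeight (filling T) (suc p) j)
  columnContains⇔ T p j = mk⇔ ⇒ ⇐
    where
    F = filling T
    ⇒ : ColumnContains s F (1+ p) (1+ j) → colHeight F p j ≢ colHeight F (suc p) j
    ⇒ (1+ r , x , eq) h≡ = <-irrefl refl (subst (λ v → toℕ v ≤ p) eq
      (proj₂ (<colHeight⁻ T (subst (r <_) (sym h≡)
        (<colHeight⁺ F (proj₁ x , λ _ → ≤-reflexive (cong toℕ eq))))) x))
    ⇐ : colHeight F p j ≢ colHeight F (suc p) j → ColumnContains s F (1+ p) (1+ j)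
    -- The witness is the row with index `colHeight F p j`, the first one whose entry exceeds `p`;
    -- as the heights differ, this entry is at most `suc p`.
    ⇐ h≢ with <colHeight⁻ T (≤∧≢⇒< (colHeight-≤ T F (λ _ → m≤n⇒m≤1+n) j) h≢)
    ... | o , f with ¬below⇒cell F o (<-irrefl refl ∘ <colHeight⁺ F)
    ...   | x , p<T = 1+ colHeight F p j , x , toℕ-injective (≤-antisym (f x) p<T)

-- Merging the entries i and i + 1, and telling them apart again.

module BenderKnuth (s : SkewPartition) (m : ℕ) where

  i : ℕ₊
  i = 1+ m

  -- As `toℕ i` is `suc m`, these are the values `i` and `next i`, given as an interval to suit
  -- order arguments.
  Mid : ℕ₊ → Set
  Mid v = m < toℕ v × toℕ v ≤ suc (suc m)

  mid? : ∀ v → Dec (Mid v)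
  mid? v = m <? toℕ v ×-dec toℕ v ≤? suc (suc m)

  mid-i : Mid i
  mid-i = ≤-refl , n≤1+n _

  mid-next : Mid (next i)
  mid-next = n≤1+n _ , ≤-refl

  collapse : ℕ₊ → ℕ₊
  collapse v with mid? v
  ... | yes _ = i
  ... | no  _ = v

  collapse-mid : ∀ {v} → Mid v → collapse v ≡ i
  collapse-mid {v} mid with mid? v
  ... | yes _   = refl
  ... | no ¬mid = contradiction mid ¬mid

  collapse-≡ : ∀ {v w} → collapse v ≡ collapse w → v ≡ w ⊎ (Mid v × Mid w)
  collapse-≡ {v} {w} eq with mid? v | mid? w
  ... | yes p | yes q = inj₂ (p , q)
  ... | no _  | no _  = inj₁ eq
  ... | yes p | no ¬q = contradiction (subst Mid eq mid-i) ¬q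
  ... | no ¬p | yes _ = contradiction (subst Mid (sym eq) mid-i) ¬p

  mid-≤i : ∀ {v} → Mid v → toℕ v ≤ suc m → v ≡ i
  mid-≤i (m<v , _) v≤ = toℕ-injective (≤-antisym v≤ m<v)

  mid-≰i : ∀ {v} → Mid v → ¬ toℕ v ≤ suc m → v ≡ next i
  mid-≰i (_ , v≤) v≰ = toℕ-injective (≤-antisym v≤ (≰⇒> v≰))

  collapse-≤i-injective : ∀ {v w} → collapse v ≡ collapse w → (toℕ v ≤ suc m ⇔ toℕ w ≤ suc m) → v ≡ w
  collapse-≤i-injective {v} eq v⇔w with collapse-≡ eq
  ... | inj₁ v≡w = v≡w
  ... | inj₂ (p , q) with toℕ v ≤? suc m
  ...   | yes v≤ = trans (mid-≤i p v≤) (sym (mid-≤i q (v⇔w .to v≤)))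
  ...   | no  v≰ = trans (mid-≰i p v≰) (sym (mid-≰i q (v≰ ∘ v⇔w .from)))

  -- The threshold `suc m` is the only one that separates `i` from `next i`.
  collapse-≤ : ∀ {p} → p ≢ suc m → ∀ {v w} → collapse v ≡ collapse w → toℕ v ≤ p → toℕ w ≤ p
  collapse-≤ p≢ eq v≤p with collapse-≡ eq
  ... | inj₁ refl = v≤p
  ... | inj₂ ((m<v , _) , (_ , w≤)) = ≤-trans w≤ (≤∧≢⇒< (≤-trans m<v v≤p) (p≢ ∘ sym))

  recolour : (b r : ℕ) → ℕ₊ → ℕ₊
  recolour b r v with mid? v | r <? b
  ... | no _  | _     = v
  ... | yes _ | yes _ = i
  ... | yes _ | no  _ = next i

  data Recoloured (b r : ℕ) (v : ℕ₊) : ℕ₊ → Set where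
    fixed : ¬ Mid v → Recoloured b r v v
    lo    : Mid v → r < b → Recoloured b r v i
    hi    : Mid v → b ≤ r → Recoloured b r v (next i)

  recoloured : ∀ b r v → Recoloured b r v (recolour b r v)
  recoloured b r v with mid? v | r <? b
  ... | no ¬mid | _       = fixed ¬mid
  ... | yes mid | yes r<b = lo mid r<b
  ... | yes mid | no  r≮b = hi mid (≮⇒≥ r≮b)

  collapse-recolour : ∀ b r v → collapse (recolour b r v) ≡ collapse v
  collapse-recolour b r v with recolour b r v | recoloured b r v
  ... | _ | fixed _  = refl
  ... | _ | lo mid _ = trans (collapse-mid mid-i) (sym (collapse-mid mid))
  ... | _ | hi mid _ = trans (collapse-mid mid-next) (sym (collapse-mid mid))

  -- The only dangerous case, `next i` before `i`, would need `b ≤ r ≤ r′ < b′ ≤ b`.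
  recolour-mono : ∀ {b b′ r r′ v v′} → b′ ≤ b → r ≤ r′ → v ≤₊ v′ →
                  recolour b r v ≤₊ recolour b′ r′ v′
  recolour-mono {b} {b′} {r} {r′} {v} {v′} b′≤b r≤r′ v≤v′
    with recolour b r v | recoloured b r v | recolour b′ r′ v′ | recoloured b′ r′ v′
  ... | _ | fixed _      | _ | fixed _        = v≤v′
  ... | _ | fixed ¬mid   | _ | lo (_ , v′≤) _ = m≤n⇒m≤1+n (≮⇒≥ λ m<v → ¬mid (m<v , ≤-trans v≤v′ v′≤))
  ... | _ | fixed _      | _ | hi (_ , v′≤) _ = ≤-trans v≤v′ v′≤
  ... | _ | lo (m<v , _) _ | _ | fixed _      = ≤-trans m<v v≤v′
  ... | _ | hi (m<v , _) _ | _ | fixed ¬mid′  = <⇒≤ (≰⇒> λ v′≤ → ¬mid′ (≤-trans m<v v≤v′ , v′≤))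
  ... | _ | lo _ _       | _ | lo _ _         = ≤-refl
  ... | _ | lo _ _       | _ | hi _ _         = n≤1+n _
  ... | _ | hi _ _       | _ | hi _ _         = ≤-refl
  ... | _ | hi _ b≤r     | _ | lo _ r′<b′     =
    contradiction (≤-trans b′≤b (≤-trans b≤r r≤r′)) (<⇒≱ r′<b′)

  -- Heights are at most `rowBound s`; the extra 1 makes `N` nonzero and different from every
  -- height.
  N : ℕ
  N = suc (rowBound s)

  -- The profile of an rpp and the graph of the involution.

  open Codes N
  open Profile

  a b c : RPP s → ℕ → ℕ
  a T = colHeight s (filling T) m
  b T = colHeight s (filling T) (suc m)
  c T = colHeight s (filling T) (suc (suc m))

  profile : ∀ T → Profile (a T) (c T) (b T)
  profile T .a≤b = colHeight-≤ s T (filling T) λ _ → m≤n⇒m≤1+n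
  profile T .b≤c = colHeight-≤ s T (filling T) λ _ → m≤n⇒m≤1+n
  profile T .b↘  = colHeight-antitone s T (suc m)

  c≤N : ∀ T j → c T j ≤ N
  c≤N T j = m≤n⇒m≤1+n (height-≤ (λ r → below? s (filling T) (suc (suc m)) r j) (rowBound s))

  SameFrame : RPP s → RPP s → Set
  SameFrame T U = ∀ q → collapse (filling T q) ≡ collapse (filling U q)

  frame-colHeight : ∀ {T U} → SameFrame T U → ∀ {p} → p ≢ suc m →
                    colHeight s (filling T) p ≗ colHeight s (filling U) p
  frame-colHeight {T} {U} same p≢ j = ≤-antisym
    (colHeight-≤ s T (filling U) (λ q → collapse-≤ p≢ (same q)) j)
    (colHeight-≤ s U (filling T) (λ q → collapse-≤ p≢ (sym (same q))) j)

  frame-a : ∀ {T U} → SameFrame T U → a T ≗ a U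
  frame-a {T} {U} same = frame-colHeight {T} {U} same (1+n≢n ∘ sym)

  frame-c : ∀ {T U} → SameFrame T U → c T ≗ c U
  frame-c {T} {U} same = frame-colHeight {T} {U} same 1+n≢n

  -- The graph of the involution. Existence and uniqueness of `U` yield the map and its
  -- compatibility with equality; symmetry yields involutivity.
  record Linked (T U : RPP s) : Set where
    field
      frame    : SameFrame T U
      transfer : Transfer (a T) (c T) (columnBound s) (b T) (b U)

  open Linked

  profile-frame : ∀ T U → SameFrame T U → Profile (a T) (c T) (b U)
  profile-frame T U same .a≤b j = subst (_≤ b U j) (sym (frame-a {T} {U} same j)) (profile U .a≤b j)
  profile-frame T U same .b≤c j = subst (b U j ≤_) (sym (frame-c {T} {U} same j)) (profile U .b≤c j)
  profile-frame T U same .b↘    = profile U .b↘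

  a↘ : ∀ T → Antitone (a T)
  a↘ T = colHeight-antitone s T m

  c↘ : ∀ T → Antitone (c T)
  c↘ T = colHeight-antitone s T (suc (suc m))

  linked-sym : ∀ {T U} → Linked T U → Linked U T
  linked-sym l .frame q = sym (l .frame q)
  linked-sym {T} {U} l .transfer =
    transfer-resp-≗ (frame-a {T} {U} (l .frame)) (frame-c {T} {U} (l .frame)) (λ _ → refl) (λ _ → refl)
      (transfer-sym (a↘ T) (c↘ T) (c≤N T) (columnBound s)
        (profile T) (profile-frame T U (l .frame)) (l .transfer))

  open Setoid (RPPₛ s) using (_≈_)

  linked-respˡ : ∀ {T T′ U} → T ≈ T′ → Linked T U → Linked T′ U
  linked-respˡ T≈ l .frame q = trans (cong collapse (sym (T≈ q))) (l .frame q)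
  linked-respˡ {T} {T′} T≈ l .transfer =
    transfer-resp-≗ (same m) (same (suc (suc m))) (same (suc m)) (λ _ → refl) (l .transfer)
    where
    same : ∀ p → colHeight s (filling T) p ≗ colHeight s (filling T′) p
    same p j = ≤-antisym
      (colHeight-≤ s T (filling T′) (λ q → subst (λ v → toℕ v ≤ p) (T≈ q)) j)
      (colHeight-≤ s T′ (filling T) (λ q → subst (λ v → toℕ v ≤ p) (sym (T≈ q))) j)

  ≤i⇔ : ∀ (T : RPP s) {r j} (x : (1+ r , 1+ j) ∈ SkewDiagram s) →
        toℕ (filling T ((1+ r , 1+ j) , [ x ])) ≤ suc m ⇔ r < b T j
  ≤i⇔ T x = mk⇔ (λ ≤i → <colHeight⁺ s (filling T) (proj₁ x , λ _ → ≤i))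
                (λ r<b → proj₂ (<colHeight⁻ s T r<b) x)

  -- The common frame fixes each entry up to the choice between `i` and `next i`, and the height `b`
  -- of the column decides that choice.
  linked-functional : ∀ {T U V} → Linked T U → Linked T V → U ≈ V
  linked-functional {T} {U} {V} l k ((1+ r , 1+ j) , [ x ]) =
    collapse-≤i-injective (trans (sym (l .frame _)) (k .frame _))
      (mk⇔ (λ ≤i → ≤i⇔ V y .from (subst (r <_) b≡ (≤i⇔ U y .to ≤i)))
           (λ ≤i → ≤i⇔ U y .from (subst (r <_) (sym b≡) (≤i⇔ V y .to ≤i))))
    where
    y : (1+ r , 1+ j) ∈ SkewDiagram s
    -- Membership in a cell is irrelevant; decidability recovers a proof that can be used.
    y = recompute (inDiagram? s _) x
    b≡ : b U j ≡ b V j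
    b≡ = transfer-functional (a↘ T) (c↘ T) (c≤N T) (columnBound s) {b T}
           (profile-frame T U (l .frame)) (profile-frame T V (k .frame)) (l .transfer) (k .transfer)
           (column≤ s {1+ r} y)

  -- Realising a profile by an rpp.

  module _ (T : RPP s) {b′ : ℕ → ℕ} (p′ : Profile (a T) (c T) b′) where

    redraw : RPP s
    redraw .filling q@((1+ r , 1+ j) , _) = recolour (b′ j) r (filling T q)
    redraw .row-weak    x x′ j≤j′ =
      recolour-mono (antitone-≤ (p′ .b↘) (s≤s⁻¹ j≤j′)) ≤-refl (row-weak T x x′ j≤j′)
    redraw .column-weak x x′ r≤r′ =
      recolour-mono ≤-refl (s≤s⁻¹ r≤r′) (column-weak T x x′ r≤r′)

    redraw-frame : SameFrame T redraw
    redraw-frame q@((1+ r , 1+ j) , _) = sym (collapse-recolour (b′ j) r (filling T q))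

    -- Entries in rows before `b′ j` were at most i + 1 because `b′ ≤ c`, so they become at most i.
    -- Entries from that row on were at least i because `a ≤ b′`, so they become larger than i.
    redraw-b : b redraw ≗ b′
    redraw-b j = ≤-antisym (<-extensional ⇒) (<-extensional ⇐)
      where
      ⇐ : ∀ {r} → r < b′ j → r < b redraw j
      ⇐ {r} r<b′ with <colHeight⁻ s T (<-≤-trans r<b′ (p′ .b≤c j))
      ... | o , f = <colHeight⁺ s (filling redraw) (o , bound)
        where
        bound : ∀ x → toℕ (filling redraw ((1+ r , 1+ j) , [ x ])) ≤ suc m
        bound x with recolour (b′ j) r (filling T ((1+ r , 1+ j) , [ x ]))
                   | recoloured (b′ j) r (filling T ((1+ r , 1+ j) , [ x ]))
        ... | _ | fixed ¬mid = m≤n⇒m≤1+n (≮⇒≥ λ m<T → ¬mid (m<T , f x))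
        ... | _ | lo _ _     = ≤-refl
        ... | _ | hi _ b′≤r  = contradiction b′≤r (<⇒≱ r<b′)
      ⇒ : ∀ {r} → r < b redraw j → r < b′ j
      ⇒ {r} r<b with <colHeight⁻ s redraw r<b
      ... | o , f = ≰⇒> λ b′≤r → absurd b′≤r
        (¬below⇒cell s (filling T) o λ below →
          <⇒≱ (<colHeight⁺ s (filling T) below) (≤-trans (p′ .a≤b j) b′≤r))
        where
        absurd : b′ j ≤ r →
                 ¬ (Σ[ x ∈ (1+ r , 1+ j) ∈ SkewDiagram s ] m < toℕ (filling T ((1+ r , 1+ j) , [ x ])))
        absurd b′≤r (x , m<T)
          with recolour (b′ j) r (filling T ((1+ r , 1+ j) , [ x ]))
             | recoloured (b′ j) r (filling T ((1+ r , 1+ j) , [ x ])) | f x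
        ... | _ | fixed ¬mid | ≤i = ¬mid (m<T , m≤n⇒m≤1+n ≤i)
        ... | _ | lo _ r<b′  | _  = <⇒≱ r<b′ b′≤r
        ... | _ | hi _ _     | ≤i = <-irrefl refl ≤i

  linked-exists : ∀ T → ∃[ U ] Linked T U
  linked-exists T with transfer-exists (a↘ T) (c↘ T) (c≤N T) (columnBound s) (profile T)
  ... | b′ , p′ , t = redraw T p′ , record
    { frame    = redraw-frame T p′
    ; transfer = transfer-resp-≗ (λ _ → refl) (λ _ → refl) (λ _ → refl) (sym ∘ redraw-b T p′) t
    }

  B : RPPₛ s ⟶ₛ RPPₛ s
  B = record
    { to   = proj₁ ∘ linked-exists
    ; cong = λ {T} {T′} T≈T′ → linked-functional {T′}
               (linked-respˡ T≈T′ (proj₂ (linked-exists T))) (proj₂ (linked-exists T′))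
    }

  -- The image of `T` is linked to its own image and, by symmetry, to `T`.
  B-involutive : Involutive _≈_ (B ⟨$⟩_)
  B-involutive T = linked-functional {B ⟨$⟩ T}
    (proj₂ (linked-exists (B ⟨$⟩ T))) (linked-sym (proj₂ (linked-exists T)))

  -- The effect on the two statistics.

  length-filter-linked : ∀ {T U} → Linked T U → {P : Pred ℕ 0ℓ} (P? : Decidable P) →
    length (filter P? (codes (a U) (c U) (b U) (columnBound s))) ≡
    length (filter P? (codes (c T) (a T) (b T) (columnBound s)))
  length-filter-linked {T} {U} l P? = trans
    (cong (length ∘ filter P?)
      (codes-resp-≗ {b = b U} (sym ∘ frame-a {T} {U} (l .frame)) (sym ∘ frame-c {T} {U} (l .frame))
        (λ _ → refl) (columnBound s)))
    (↭-length (filter-↭ P? (↭-sym (transfer-↭ (l .transfer)))))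

  nonzero? : Decidable (_≢ 0)
  nonzero? t = ¬? (t ≟ 0)

  b≢0 : ∀ T j → b T j ≢ a T j → b T j ≢ 0
  b≢0 T j b≢a b≡0 = b≢a (trans b≡0 (sym (n≤0⇒n≡0 (subst (a T j ≤_) b≡0 (profile T .a≤b j)))))

  ircont-i : ∀ T → part (ircont s (filling T)) i ≡
             length (filter nonzero? (codes (a T) (c T) (b T) (columnBound s)))
  ircont-i T = trans
    (cong (length ∘ filter (columnContains? s (filling T) i)) (map-upTo 1+_ (columnBound s)))
    (length-filter-applyUpTo (columnContains? s (filling T) i) nonzero?
      (λ j → ⇔-sym (code-≢0 1+n≢0 λ b≢a _ → b≢0 T j b≢a) ⇔-∘
             (mk⇔ ≢-sym ≢-sym ⇔-∘ columnContains⇔ s T m j))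
      (columnBound s))

  -- In the exchanged word the letter 0 marks the columns with `b = c`, those without i + 1.
  ircont-next : ∀ T → part (ircont s (filling T)) (next i) ≡
                length (filter nonzero? (codes (c T) (a T) (b T) (columnBound s)))
  ircont-next T = trans
    (cong (length ∘ filter (columnContains? s (filling T) (next i))) (map-upTo 1+_ (columnBound s)))
    (length-filter-applyUpTo (columnContains? s (filling T) (next i)) nonzero?
      (λ j → ⇔-sym (code-≢0 1+n≢0 λ _ b≢a → b≢0 T j b≢a) ⇔-∘ columnContains⇔ s T (suc m) j)
      (columnBound s))

  linked-ircont-i : ∀ {T U} → Linked T U →
                    part (ircont s (filling U)) i ≡ part (ircont s (filling T)) (next i)
  linked-ircont-i {T} {U} l =
    trans (ircont-i U) (trans (length-filter-linked l nonzero?) (sym (ircont-next T)))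

  linked-ircont-other : ∀ {T U} → Linked T U → ∀ {k} → k ≢ i → k ≢ next i →
                        part (ircont s (filling U)) k ≡ part (ircont s (filling T)) k
  linked-ircont-other {T} {U} l {k} k≢i k≢next =
    cong length (filter-≐ (columnContains? s (filling U) k) (columnContains? s (filling T) k)
      (map₂ (map₂ (same (sym (l .frame _)))) , map₂ (map₂ (same (l .frame _))))
      (map 1+_ (upTo (columnBound s))))
    where
    same : ∀ {v w} → collapse v ≡ collapse w → v ≡ k → w ≡ k
    same {v} eq refl with collapse-≡ eq
    ... | inj₁ v≡w = sym v≡w
    ... | inj₂ (mid , _) with toℕ v ≤? suc m
    ...   | yes v≤ = contradiction (mid-≤i mid v≤) k≢i
    ...   | no  v≰ = contradiction (mid-≰i mid v≰) k≢next

  linked-ircont : ∀ {T U} → Linked T U → ∀ k →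
                  part (ircont s (filling U)) k ≡ part (ircont s (filling T)) (transpose i (next i) k)
  linked-ircont l k with k ≟₊ i
  ... | yes refl = linked-ircont-i l
  ... | no  k≢i with k ≟₊ next i
  -- The count for i + 1 is the count for i along the reversed link.
  ...   | yes refl   = sym (linked-ircont-i (linked-sym l))
  ...   | no  k≢next = linked-ircont-other l k≢i k≢next

  -- Collapsing i + 1 to i creates exactly those equalities between rows
  -- r + 1 and r + 2 that occur in a column with letter r + 1.
  ceq-collapse : ∀ T {r} → r < rowBound s →
    part (ceq s (collapse ∘ filling T)) (1+ r) ≡
    part (ceq s (filling T)) (1+ r) + length (filter (_≟ suc r) (codes (a T) (c T) (b T) (columnBound s)))
  ceq-collapse T {r} r< = begin
    length (filter E? (map 1+_ (upTo n)))  ≡⟨ cong (length ∘ filter E?) (map-upTo 1+_ n) ⟩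
    length (filter E? (applyUpTo 1+_ n))   ≡⟨ length-filter-split E? F? (_≟ suc r) split disjoint n ⟩
    length (filter F? (applyUpTo 1+_ n)) + codeCount
      ≡⟨ cong (λ js → length (filter F? js) + codeCount) (map-upTo 1+_ n) ⟨
    length (filter F? (map 1+_ (upTo n))) + codeCount ∎
    where
    open ≡-Reasoning
    n = columnBound s
    F = filling T
    E? = equalBelow? s (collapse ∘ F) (1+ r)
    F? = equalBelow? s F (1+ r)
    codeCount = length (filter (_≟ suc r) (codes (a T) (c T) (b T) n))

    code-r⇒ : ∀ j → code (a T j) (c T j) (b T j) ≡ suc r →
              b T j ≡ suc r × b T j ≢ a T j × b T j ≢ c T j
    code-r⇒ j = code-≡ 1+n≢0 (<⇒≢ (s≤s r<))

    disjoint : ∀ j → EqualBelow s F (1+ r) (1+ j) → code (a T j) (c T j) (b T j) ≢ suc r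
    -- If `b` is `suc r`, the upper entry is at most i; equality would make the lower one at most i
    -- too, and the height would exceed `suc r`.
    disjoint j (x , x′ , eq) code≡ with code-r⇒ j code≡
    ... | b≡ , _ = <-irrefl (sym b≡)
      (≤i⇔ T x′ .to (subst (λ v → toℕ v ≤ suc m) eq (≤i⇔ T x .from (≤-reflexive (sym b≡)))))

    split : ∀ j → EqualBelow s (collapse ∘ F) (1+ r) (1+ j) ⇔
                  (EqualBelow s F (1+ r) (1+ j) ⊎ code (a T j) (c T j) (b T j) ≡ suc r)
    split j = mk⇔ ⇒ ⇐
      where
      ⇒ : EqualBelow s (collapse ∘ F) (1+ r) (1+ j) →
          EqualBelow s F (1+ r) (1+ j) ⊎ code (a T j) (c T j) (b T j) ≡ suc r
      ⇒ (x , x′ , eq) with collapse-≡ eq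
      ... | inj₁ same = inj₁ (x , x′ , same)
      -- Two different merged entries are i above i + 1, so the boundary `b` lies between them, at
      -- height `suc r`, strictly between `a` and `c`.
      ... | inj₂ (p , p′) with F ((1+ r , 1+ j) , [ x ]) ≟₊ F ((1+ suc r , 1+ j) , [ x′ ])
      ...   | yes same = inj₁ (x , x′ , same)
      ...   | no  differ = inj₂ (trans (code-other b≢a b≢c) b≡)
        where
        F≤F′ : F ((1+ r , 1+ j) , [ x ]) ≤₊ F ((1+ suc r , 1+ j) , [ x′ ])
        F≤F′ = column-weak T x x′ (n≤1+n _)
        F<F′ : toℕ (F ((1+ r , 1+ j) , [ x ])) < toℕ (F ((1+ suc r , 1+ j) , [ x′ ]))
        F<F′ = ≤∧≢⇒< F≤F′ (differ ∘ toℕ-injective)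
        F≤i : toℕ (F ((1+ r , 1+ j) , [ x ])) ≤ suc m
        F≤i = s≤s⁻¹ (≤-trans F<F′ (proj₂ p′))
        i<F′ : suc m < toℕ (F ((1+ suc r , 1+ j) , [ x′ ]))
        i<F′ = ≤-trans (s≤s (proj₁ p)) F<F′
        b≡ : b T j ≡ suc r
        b≡ = ≤-antisym (≮⇒≥ (<⇒≱ i<F′ ∘ ≤i⇔ T x′ .from)) (≤i⇔ T x .to F≤i)
        b≢a : b T j ≢ a T j
        b≢a b≡a = <⇒≱ (proj₁ p) (proj₂ (<colHeight⁻ s T (≤-reflexive (trans (sym b≡) b≡a))) x)
        b≢c : b T j ≢ c T j
        b≢c b≡c = <-irrefl (trans (sym b≡) b≡c) (<colHeight⁺ s F (proj₁ x′ , λ _ → proj₂ p′))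
      ⇐ : EqualBelow s F (1+ r) (1+ j) ⊎ code (a T j) (c T j) (b T j) ≡ suc r →
          EqualBelow s (collapse ∘ F) (1+ r) (1+ j)
      ⇐ (inj₁ (x , x′ , eq)) = x , x′ , cong collapse eq
      -- Now `a < suc r < c`, so row index `r` is at or past `a` and row index `suc r` is still
      -- before `c`: both cells carry merged entries.
      ⇐ (inj₂ code≡) with code-r⇒ j code≡
      ... | b≡ , b≢a , b≢c = x , x′ ,
        trans (collapse-mid (m<F , ≤-trans F≤F′ F′≤)) (sym (collapse-mid (≤-trans m<F F≤F′ , F′≤)))
        where
        r<b : r < b T j
        r<b = ≤-reflexive (sym b≡)
        1+r<c : suc r < c T j
        1+r<c = subst (_< c T j) b≡ (≤∧≢⇒< (profile T .b≤c j) b≢c)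
        r≮a : ¬ Below s F m r j
        r≮a below = <⇒≱ (≤∧≢⇒< (profile T .a≤b j) (≢-sym b≢a))
                          (subst (_≤ a T j) (sym b≡) (<colHeight⁺ s F below))
        cell = ¬below⇒cell s F (proj₁ (<colHeight⁻ s T r<b)) r≮a
        x    = proj₁ cell
        m<F  = proj₂ cell
        below′ = <colHeight⁻ s T 1+r<c
        x′ : (1+ suc r , 1+ j) ∈ SkewDiagram s
        x′ = proj₁ below′ , proj₂ x ∘ diagram-closed s (inner s) (n≤1+n r) ≤-refl
        F′≤ = proj₂ below′ x′
        F≤F′ = column-weak T x x′ (n≤1+n _)

  -- Equal frames have equal collapsed `ceq`. The surplus created by collapsing is a count of
  -- letters that neither the exchange nor the repair changes, so it cancels.
  linked-ceq : ∀ {T U} → Linked T U → ∀ k → part (ceq s (filling U)) k ≡ part (ceq s (filling T)) k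
  linked-ceq {T} {U} l (1+ r) with r <? rowBound s
  -- Beyond the last row both counts vanish; within it, `suc r` differs from `N`.
  ... | no r≮ = trans (ceq s (filling U) .finite .proj₂ (s≤s (≮⇒≥ r≮)))
                      (sym (ceq s (filling T) .finite .proj₂ (s≤s (≮⇒≥ r≮))))
  ... | yes r< = +-cancelʳ-≡ (codeCount T) _ _ (begin
    part (ceq s (filling U)) (1+ r) + codeCount T
      ≡⟨ cong (part (ceq s (filling U)) (1+ r) +_) codeCount≡ ⟩
    part (ceq s (filling U)) (1+ r) + codeCount U    ≡⟨ ceq-collapse U r< ⟨
    part (ceq s (collapse ∘ filling U)) (1+ r)       ≡⟨ same ⟩
    part (ceq s (collapse ∘ filling T)) (1+ r)       ≡⟨ ceq-collapse T r< ⟩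
    part (ceq s (filling T)) (1+ r) + codeCount T    ∎)
    where
    open ≡-Reasoning
    codeCount : RPP s → ℕ
    codeCount V = length (filter (_≟ suc r) (codes (a V) (c V) (b V) (columnBound s)))
    codeCount≡ : codeCount T ≡ codeCount U
    codeCount≡ = trans
      (codes-swap-count (a T) (c T) (b T) 1+n≢0 (<⇒≢ (s≤s r<)) (columnBound s))
      (sym (length-filter-linked l (_≟ suc r)))
    same : part (ceq s (collapse ∘ filling U)) (1+ r) ≡ part (ceq s (collapse ∘ filling T)) (1+ r)
    same = cong length (filter-≐
      (equalBelow? s (collapse ∘ filling U) (1+ r)) (equalBelow? s (collapse ∘ filling T) (1+ r))
      ( (λ (x , x′ , eq) → x , x′ , trans (l .frame _) (trans eq (sym (l .frame _))))
      , (λ (x , x′ , eq) → x , x′ , trans (sym (l .frame _)) (trans eq (l .frame _))))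
      (map 1+_ (upTo (columnBound s))))

theorem3p4 : (s : SkewPartition) (i : ℕ₊) →
    Σ[ B ∈ RPPₛ s ⟶ₛ RPPₛ s ]
    Involutive (Setoid._≈_ (RPPₛ s)) (B ⟨$⟩_)
    × (∀ (T : RPP s) (k : ℕ₊) →
    part (ceq s (filling (B ⟨$⟩ T))) k ≡ part (ceq s (filling T)) k)
    × (∀ (T : RPP s) (k : ℕ₊) →
    part (ircont s (filling (B ⟨$⟩ T))) k ≡ part (ircont s (filling T)) (transpose i (next i) k))
theorem3p4 s (1+ m) =
  B , B-involutive , linked-ceq ∘ proj₂ ∘ linked-exists , linked-ircont ∘ proj₂ ∘ linked-exists
  where open BenderKnuth s m
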